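{- The identities (A5) $x\wedge(y\wedge z)\approx (y\wedge x)\wedge z$, (J5') $x\approx (x'\wedge y)'\wedge(x'\wedge y')'$ form a 2-base for the variety $\mathbb{BA}$ of Boolean algebras (in the language $\langle\wedge,{}'\rangle$).
   Context: Algebras are of type $\langle \wedge, {}'\rangle$ with $\wedge$ binary and ${}'$ unary. The variety $\mathbb{BA}$ of Boolean algebras in this language consists of the algebras $\langle B,\wedge,{}'\rangle$ obtained from Boolean algebras by keeping only meet and complement (equivalently, the variety generated by the two-element Boolean algebra with meet and complement). A base for a variety is an independent set of identities (no identity in the set follows from the others) that defines the variety; an $n$-base is a base with exactly $n$ identities. -}

module Defs where

open import Algebra.Core using (Op₁; Op₂)
open import Algebra.Definitions using (Congruent₁; Congruent₂)
open import Algebra.Lattice.Structures using (IsBooleanAlgebra)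
open import Data.Nat.Base using (ℕ)
open import Data.Product.Base using (∃-syntax; _×_; _,_)
open import Data.Vec.Base using (Vec)
open import Data.Vec.Membership.Propositional using () renaming (_∈_ to _∈ᵛ_)
open import Data.Vec.Relation.Unary.Unique.Propositional using (Unique)
open import Function.Bundles using (_⇔_)
open import Level using (Level; _⊔_; 0ℓ) renaming (suc to lsuc)
open import Relation.Binary.Core using (Rel)
open import Relation.Binary.PropositionalEquality.Core using (_≢_)
open import Relation.Binary.Structures using (IsEquivalence)
open import Relation.Nullary.Negation.Core using (¬_)
open import Relation.Unary using (Pred; _∈_)

infixr 7 _⋏_
infix  8 _ᶜ
infix  4 _≋_

data Term : Set where
  var : ℕ → Term
  _⋏_ : Term → Term → Term
  _ᶜ  : Term → Term

record Identity : Set where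
  constructor _≋_
  field
    lhs rhs : Term

-- As usual in universal algebra the universe is nonempty.  Since the
-- language has no constants this has to be required separately, and it
-- is what provides the top and bottom of a Boolean algebra.
record Algebra (a ℓ : Level) : Set (lsuc (a ⊔ ℓ)) where
  infixr 7 _∧_
  infix  8 _′
  infix  4 _≈_
  field
    Carrier       : Set a
    _≈_           : Rel Carrier ℓ
    isEquivalence : IsEquivalence _≈_
    _∧_           : Op₂ Carrier
    _′            : Op₁ Carrier
    ∧-cong        : Congruent₂ _≈_ _∧_
    ′-cong        : Congruent₁ _≈_ _′
    element       : Carrier

module _ {a ℓ : Level} (A : Algebra a ℓ) where
  private module A = Algebra A

  eval : (ℕ → A.Carrier) → Term → A.Carrier
  eval ρ (var i) = ρ i
  eval ρ (s ⋏ t) = eval ρ s A.∧ eval ρ t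
  eval ρ (t ᶜ)   = (eval ρ t) A.′

  infix 4 _⊨_ _⊨ˢ_

  _⊨_ : Identity → Set (a ⊔ ℓ)
  _⊨_ (s ≋ t) = ∀ ρ → eval ρ s A.≈ eval ρ t

  _⊨ˢ_ : Pred Identity 0ℓ → Set (a ⊔ ℓ)
  _⊨ˢ_ S = ∀ {e} → e ∈ S → _⊨_ e

-- The levels are those of the algebras quantified over.
module _ (a ℓ : Level) where

  FollowsFrom : Identity → Pred Identity 0ℓ → Set (lsuc (a ⊔ ℓ))
  FollowsFrom e S = (A : Algebra a ℓ) → A ⊨ˢ S → A ⊨ e

  Independent : Pred Identity 0ℓ → Set (lsuc (a ⊔ ℓ))
  Independent S = ∀ {e} → e ∈ S → ¬ FollowsFrom e (λ f → f ∈ S × f ≢ e)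

  Defines : ∀ {v} → Pred Identity 0ℓ → Pred (Algebra a ℓ) v → Set (lsuc (a ⊔ ℓ) ⊔ v)
  Defines S V = (A : Algebra a ℓ) → (A ⊨ˢ S) ⇔ (A ∈ V)

  IsBase : ∀ {v} → Pred Identity 0ℓ → Pred (Algebra a ℓ) v → Set (lsuc (a ⊔ ℓ) ⊔ v)
  IsBase S V = Independent S × Defines S V

  IsNBase : ∀ {v} (n : ℕ) → Vec Identity n → Pred (Algebra a ℓ) v → Set (lsuc (a ⊔ ℓ) ⊔ v)
  IsNBase n es V = Unique es × IsBase (_∈ᵛ es) V

-- The reducts to meet and complement of Boolean algebras.
BA : ∀ {a ℓ} → Pred (Algebra a ℓ) (a ⊔ ℓ)
BA A = ∃[ join ] ∃[ ⊤ ] ∃[ ⊥ ] IsBooleanAlgebra A._≈_ join A._∧_ A._′ ⊤ ⊥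
  where module A = Algebra A

private
  x y z : Term
  x = var 0
  y = var 1
  z = var 2

A5 : Identity
A5 = x ⋏ (y ⋏ z) ≋ (y ⋏ x) ⋏ z

J5′ : Identity
J5′ = x ≋ (x ᶜ ⋏ y) ᶜ ⋏ (x ᶜ ⋏ y ᶜ) ᶜ

{-# OPTIONS --safe #-}

-- Write x ↑ y for (x ′ ∧ y) ′, so that J5′ reads x ≈ x ↑ y ∧ x ↑ (y ′), and
-- A5 says that left multiplications compose in reverse:
-- (y ∧ x) ∧ z ≈ x ∧ (y ∧ z).  Together they give
-- x ∧ z ≈ x ↑ (y ′) ∧ (x ↑ y ∧ z), whence x commutes with every x ↑ y.
-- Splitting x along y ′ ∧ y ′ makes x ↑ (y ′ ∧ y ′) also of the form y ↑ _,
-- hence commute with y, and this yields x ∧ y ≈ y ∧ x.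
-- What is left is the dual of Huntington's axiomatisation: J5′ is his
-- equation, and in a commutative semigroup it makes _∧_ and _′ Boolean.

module Submission where

open import Defs
open import Level using (Level; Lift; lift; lower)
open import Data.Vec.Base using (_∷_; [])
import Algebra.Definitions as Definitions
open import Algebra.Bundles using (CommutativeSemigroup)
open import Algebra.Core using (Op₁; Op₂)
open import Algebra.Lattice.Bundles using (BooleanAlgebra)
import Algebra.Lattice.Properties.BooleanAlgebra as BooleanAlgebraProperties
open import Algebra.Lattice.Structures using (IsBooleanAlgebra)
open import Algebra.Lattice.Structures.Biased
  using (isDistributiveLatticeʳʲᵐ; isBooleanAlgebraʳ)
import Algebra.Properties.CommutativeSemigroup as CommutativeSemigroupProperties
open import Data.Bool.Base using (Bool; true; false)
open import Data.Nat.Base using (ℕ; zero; suc)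
open import Data.Product.Base using (_,_)
open import Data.Vec.Membership.Propositional using () renaming (_∈_ to _∈ᵛ_)
open import Data.Vec.Relation.Unary.All using ([]; _∷_)
open import Data.Vec.Relation.Unary.AllPairs using ([]; _∷_)
open import Data.Vec.Relation.Unary.Any using (here; there)
open import Function.Base using (const; id)
open import Function.Bundles using (mk⇔)
open import Relation.Binary.Bundles using (Setoid)
open import Relation.Binary.PropositionalEquality
  using (_≡_; refl; sym; trans; cong; cong₂)
import Relation.Binary.Reasoning.Setoid as SetoidReasoning
open import Relation.Binary.Structures using (IsEquivalence)
open import Relation.Nullary.Negation.Core using (contradiction)

-- Boolean structure derived from the two identities

module FromA5-J5′ {a ℓ : Level} (A : Algebra a ℓ)
  (a5 : A ⊨ A5) (j5′ : A ⊨ J5′) where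

  open Algebra A

  private
    module E = IsEquivalence isEquivalence

    setoid : Setoid a ℓ
    setoid = record { isEquivalence = isEquivalence }

  open Definitions _≈_
  open SetoidReasoning setoid

  infixr 8 _↑_

  _↑_ : Op₂ Carrier
  x ↑ y = (x ′ ∧ y) ′

  ∧-congˡ : LeftCongruent _∧_
  ∧-congˡ = ∧-cong E.refl

  ∧-congʳ : RightCongruent _∧_
  ∧-congʳ x≈y = ∧-cong x≈y E.refl

  assign : Carrier → Carrier → Carrier → ℕ → Carrier
  assign x y z 0             = x
  assign x y z 1             = y
  assign x y z (suc (suc _)) = z

  twist : ∀ x y z → x ∧ (y ∧ z) ≈ (y ∧ x) ∧ z
  twist x y z = a5 (assign x y z)

  split : ∀ x y → x ≈ x ↑ y ∧ x ↑ (y ′)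
  split x y = j5′ (assign x y y)

  -- Commutativity

  -- Left multiplications by `w`, `z`-style factors compose in reverse: the composite for `x`, `y`,
  -- `z` is left multiplication by `(z ∧ y) ∧ x`, which A5 turns into `y ∧ (z ∧ x)`, the element for
  -- `x`, `z`, `y`.
  swap-middle : ∀ x y z w → x ∧ (y ∧ (z ∧ w)) ≈ x ∧ (z ∧ (y ∧ w))
  swap-middle x y z w = begin
    x ∧ (y ∧ (z ∧ w))  ≈⟨ ∧-congˡ (twist y z w) ⟩
    x ∧ ((z ∧ y) ∧ w)  ≈⟨ twist x (z ∧ y) w ⟩
    ((z ∧ y) ∧ x) ∧ w  ≈⟨ ∧-congʳ (twist y z x) ⟨
    (y ∧ (z ∧ x)) ∧ w  ≈⟨ twist (z ∧ x) y w ⟨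
    (z ∧ x) ∧ (y ∧ w)  ≈⟨ twist x z (y ∧ w) ⟨
    x ∧ (z ∧ (y ∧ w))  ∎

  merge : ∀ x y z → x ↑ (y ′) ∧ (x ↑ y ∧ z) ≈ x ∧ z
  merge x y z = begin
    x ↑ (y ′) ∧ (x ↑ y ∧ z)  ≈⟨ twist _ _ z ⟩
    (x ↑ y ∧ x ↑ (y ′)) ∧ z  ≈⟨ ∧-congʳ (split x y) ⟨
    x ∧ z                    ∎

  ∧-comm-↑′ : ∀ x y → x ∧ x ↑ (y ′) ≈ x ↑ (y ′) ∧ x
  ∧-comm-↑′ x y = begin
    x ∧ x ↑ (y ′)                    ≈⟨ merge x y (x ↑ (y ′)) ⟨
    x ↑ (y ′) ∧ (x ↑ y ∧ x ↑ (y ′))  ≈⟨ ∧-congˡ (split x y) ⟨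
    x ↑ (y ′) ∧ x                    ∎

  -- Splitting `x ′ ∧ y` along `x ↑ (y ′)` works because J5′ collapses the first factor to `x ′`,
  -- while the second is a complement. This lifts `∧-comm-↑′` to arbitrary `y`.
  ↑-as-↑′ : ∀ x y → x ↑ y ≈ x ↑ ((x ↑ y ∧ (x ↑ (y ′)) ′) ′)
  ↑-as-↑′ x y = ′-cong (begin
    x ′ ∧ y                                              ≈⟨ split (x ′ ∧ y) (x ↑ (y ′)) ⟩
    (x ↑ y ∧ x ↑ (y ′)) ′ ∧ (x ↑ y ∧ (x ↑ (y ′)) ′) ′    ≈⟨ ∧-congʳ (′-cong (split x y)) ⟨
    x ′ ∧ (x ↑ y ∧ (x ↑ (y ′)) ′) ′                      ∎)

  ∧-comm-↑ : ∀ x y → x ∧ x ↑ y ≈ x ↑ y ∧ x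
  ∧-comm-↑ x y = begin
    x ∧ x ↑ y       ≈⟨ ∧-congˡ (↑-as-↑′ x y) ⟩
    x ∧ x ↑ (w ′)   ≈⟨ ∧-comm-↑′ x w ⟩
    x ↑ (w ′) ∧ x   ≈⟨ ∧-congʳ (↑-as-↑′ x y) ⟨
    x ↑ y ∧ x       ∎
    where w = x ↑ y ∧ (x ↑ (y ′)) ′

  -- Complementing the splitting of `y` along `x` exhibits `y ′` as `u ↑ _` with `u = y ′ ∧ x`, so
  -- `u` commutes with it.
  ′∧-comm-′ : ∀ x y → (y ′ ∧ x) ∧ y ′ ≈ y ′ ∧ (y ′ ∧ x)
  ′∧-comm-′ x y = begin
    u ∧ y ′               ≈⟨ ∧-congˡ y′≈u↑v ⟩
    u ∧ u ↑ (y ↑ (x ′))   ≈⟨ ∧-comm-↑ u (y ↑ (x ′)) ⟩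
    u ↑ (y ↑ (x ′)) ∧ u   ≈⟨ ∧-congʳ y′≈u↑v ⟨
    y ′ ∧ u               ∎
    where
    u = y ′ ∧ x
    y′≈u↑v : y ′ ≈ u ↑ (y ↑ (x ′))
    y′≈u↑v = ′-cong (split y x)

  ∧-square′ : ∀ x y → x ∧ (y ′ ∧ y ′) ≈ y ′ ∧ (y ′ ∧ x)
  ∧-square′ x y = E.trans (twist x (y ′) (y ′)) (′∧-comm-′ x y)

  ∧-∧-square′ : ∀ x y z → x ∧ (y ∧ (z ′ ∧ z ′)) ≈ z ′ ∧ (y ∧ (z ′ ∧ x))
  ∧-∧-square′ x y z = begin
    x ∧ (y ∧ (z ′ ∧ z ′))  ≈⟨ twist x y (z ′ ∧ z ′) ⟩
    (y ∧ x) ∧ (z ′ ∧ z ′)  ≈⟨ ∧-square′ (y ∧ x) z ⟩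
    z ′ ∧ (z ′ ∧ (y ∧ x))  ≈⟨ swap-middle (z ′) (z ′) y x ⟩
    z ′ ∧ (y ∧ (z ′ ∧ x))  ∎

  ∧-rotate-↑ : ∀ x y z → x ∧ (x ↑ y ∧ z) ≈ z ∧ (x ∧ x ↑ y)
  ∧-rotate-↑ x y z = begin
    x ∧ (x ↑ y ∧ z)                    ≈⟨ twist x (x ↑ y) z ⟩
    (x ↑ y ∧ x) ∧ z                    ≈⟨ ∧-congʳ (∧-comm-↑ x y) ⟨
    (x ∧ x ↑ y) ∧ z                    ≈⟨ twist (x ↑ y) x z ⟨
    x ↑ y ∧ (x ∧ z)                    ≈⟨ ∧-congˡ (merge x y z) ⟨
    -- `x ↑ y` is itself a complement, so its two copies can be gathered into a square while `z`
    -- moves to the front.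
    x ↑ y ∧ (x ↑ (y ′) ∧ (x ↑ y ∧ z))  ≈⟨ ∧-∧-square′ z (x ↑ (y ′)) (x ′ ∧ y) ⟨
    z ∧ (x ↑ (y ′) ∧ (x ↑ y ∧ x ↑ y))  ≈⟨ ∧-congˡ (merge x y (x ↑ y)) ⟩
    z ∧ (x ∧ x ↑ y)                    ∎

  ∧-comm : Commutative _∧_
  ∧-comm x y = begin
    x ∧ y        ≈⟨ merge x s y ⟨
    q ∧ (p ∧ y)  ≈⟨ ∧-congˡ (∧-congʳ p≈r) ⟩
    q ∧ (r ∧ y)  ≈⟨ ∧-congˡ (∧-comm-↑ y (y ′ ∧ x ′)) ⟨
    -- The rotation brings `y` to the front and leaves behind the two factors of the splitting of
    -- `x`.
    q ∧ (y ∧ r)  ≈⟨ ∧-rotate-↑ y (y ′ ∧ x ′) q ⟨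
    y ∧ (r ∧ q)  ≈⟨ ∧-congˡ (∧-congʳ p≈r) ⟨
    y ∧ (p ∧ q)  ≈⟨ ∧-congˡ (split x s) ⟨
    y ∧ x        ∎
    where
    s = y ′ ∧ y ′
    p = x ↑ s
    q = x ↑ (s ′)
    r = y ↑ (y ′ ∧ x ′)
    p≈r : p ≈ r
    p≈r = ′-cong (∧-square′ (x ′) y)

  ∧-assoc : Associative _∧_
  ∧-assoc x y z = begin
    (x ∧ y) ∧ z  ≈⟨ ∧-congʳ (∧-comm x y) ⟩
    (y ∧ x) ∧ z  ≈⟨ twist x y z ⟨
    x ∧ (y ∧ z)  ∎

  ∧-commutativeSemigroup : CommutativeSemigroup a ℓ
  ∧-commutativeSemigroup = record
    { isCommutativeSemigroup = record
      { isSemigroup = record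
        { isMagma = record { isEquivalence = isEquivalence ; ∙-cong = ∧-cong }
        ; assoc   = ∧-assoc
        }
      ; comm = ∧-comm
      }
    }

  open CommutativeSemigroupProperties ∧-commutativeSemigroup
    using (interchange; x∙yz≈y∙xz; xy∙z≈xz∙y)

  -- Complements

  -- Splitting `x` and `x ′` along `x ′ ′`, and `x ′` and `x ′ ′` along `x ′`, produces the same
  -- four factors.
  ∧-complement-shift : ∀ x → x ∧ x ′ ≈ x ′ ∧ x ′ ′
  ∧-complement-shift x = begin
    x ∧ x ′
      ≈⟨ ∧-cong (split x (x ′ ′)) (split (x ′) (x ′ ′)) ⟩
    ((x ′ ∧ x ′ ′) ′ ∧ (x ′ ∧ x ′ ′ ′) ′) ∧ ((x ′ ′ ∧ x ′ ′) ′ ∧ (x ′ ′ ∧ x ′ ′ ′) ′)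
      ≈⟨ interchange _ _ _ _ ⟩
    ((x ′ ∧ x ′ ′) ′ ∧ (x ′ ′ ∧ x ′ ′) ′) ∧ ((x ′ ∧ x ′ ′ ′) ′ ∧ (x ′ ′ ∧ x ′ ′ ′) ′)
      ≈⟨ ∧-cong (∧-congʳ (′-cong (∧-comm _ _)))
                (∧-cong (′-cong (∧-comm _ _)) (′-cong (∧-comm _ _))) ⟩
    ((x ′ ′ ∧ x ′) ′ ∧ (x ′ ′ ∧ x ′ ′) ′) ∧ ((x ′ ′ ′ ∧ x ′) ′ ∧ (x ′ ′ ′ ∧ x ′ ′) ′)
      ≈⟨ ∧-cong (split (x ′) (x ′)) (split (x ′ ′) (x ′)) ⟨
    x ′ ∧ x ′ ′ ∎

  -- The splittings of `x ′ ′` along `x ′` and of `x` along `x ′ ′` differ in one factor only, and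
  -- `∧-complement-shift` at `x ′` identifies the two.
  ′-involutive : Involutive _′
  ′-involutive x = begin
    x ′ ′
      ≈⟨ split (x ′ ′) (x ′) ⟩
    (x ′ ′ ′ ∧ x ′) ′ ∧ (x ′ ′ ′ ∧ x ′ ′) ′
      ≈⟨ ∧-comm _ _ ⟩
    (x ′ ′ ′ ∧ x ′ ′) ′ ∧ (x ′ ′ ′ ∧ x ′) ′
      ≈⟨ ∧-cong (′-cong (∧-comm _ _)) (′-cong (∧-comm _ _)) ⟩
    (x ′ ′ ∧ x ′ ′ ′) ′ ∧ (x ′ ∧ x ′ ′ ′) ′
      ≈⟨ ∧-congʳ (′-cong (∧-complement-shift (x ′))) ⟨
    (x ′ ∧ x ′ ′) ′ ∧ (x ′ ∧ x ′ ′ ′) ′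
      ≈⟨ split x (x ′ ′) ⟨
    x ∎

  split′ : ∀ x y → x ′ ≈ (x ∧ y) ′ ∧ (x ∧ y ′) ′
  split′ x y = begin
    x ′                                ≈⟨ split (x ′) y ⟩
    (x ′ ′ ∧ y) ′ ∧ (x ′ ′ ∧ y ′) ′    ≈⟨ ∧-cong (′-cong (∧-congʳ (′-involutive x)))
                                                 (′-cong (∧-congʳ (′-involutive x))) ⟩
    (x ∧ y) ′ ∧ (x ∧ y ′) ′            ∎

  -- Both sides expand to the complements of the four products of `x` or `x ′` with `y` or `y ′`.
  ∧-complement-unique : ∀ x y → x ∧ x ′ ≈ y ∧ y ′
  ∧-complement-unique x y = begin
    x ∧ x ′
      ≈⟨ ∧-cong (split x y) (split′ x y) ⟩
    ((x ′ ∧ y) ′ ∧ (x ′ ∧ y ′) ′) ∧ ((x ∧ y) ′ ∧ (x ∧ y ′) ′)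
      ≈⟨ ∧-comm _ _ ⟩
    ((x ∧ y) ′ ∧ (x ∧ y ′) ′) ∧ ((x ′ ∧ y) ′ ∧ (x ′ ∧ y ′) ′)
      ≈⟨ interchange _ _ _ _ ⟩
    ((x ∧ y) ′ ∧ (x ′ ∧ y) ′) ∧ ((x ∧ y ′) ′ ∧ (x ′ ∧ y ′) ′)
      ≈⟨ ∧-cong (∧-cong (′-cong (∧-comm _ _)) (′-cong (∧-comm _ _)))
                (∧-cong (′-cong (∧-comm _ _)) (′-cong (∧-comm _ _))) ⟩
    ((y ∧ x) ′ ∧ (y ∧ x ′) ′) ∧ ((y ′ ∧ x) ′ ∧ (y ′ ∧ x ′) ′)
      ≈⟨ ∧-cong (split′ y x) (split y x) ⟨
    y ′ ∧ y
      ≈⟨ ∧-comm _ _ ⟩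
    y ∧ y ′ ∎

  ⊥ : Carrier
  ⊥ = element ∧ element ′

  ⊤ : Carrier
  ⊤ = ⊥ ′

  ∧-complementʳ : RightInverse ⊥ _′ _∧_
  ∧-complementʳ x = ∧-complement-unique x element

  -- Idempotence

  ⊤≈⊥⊥′∧⊤ : ⊤ ≈ (⊥ ∧ ⊥) ′ ∧ ⊤
  ⊤≈⊥⊥′∧⊤ = begin
    ⊤                        ≈⟨ split′ ⊥ ⊥ ⟩
    (⊥ ∧ ⊥) ′ ∧ (⊥ ∧ ⊤) ′    ≈⟨ ∧-congˡ (′-cong (∧-complementʳ ⊥)) ⟩
    (⊥ ∧ ⊥) ′ ∧ ⊤            ∎

  -- `⊥` absorbs the factor `(⊥ ∧ ⊥) ′`, so `⊥ ∧ ⊥` becomes a product of an element with its own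
  -- complement.
  ⊥-idem : ⊥ ∧ ⊥ ≈ ⊥
  ⊥-idem = begin
    ⊥ ∧ ⊥                    ≈⟨ ∧-congˡ ⊥≈⊥∧⊥⊥′ ⟩
    ⊥ ∧ (⊥ ∧ (⊥ ∧ ⊥) ′)      ≈⟨ ∧-assoc ⊥ ⊥ ((⊥ ∧ ⊥) ′) ⟨
    (⊥ ∧ ⊥) ∧ (⊥ ∧ ⊥) ′      ≈⟨ ∧-complementʳ (⊥ ∧ ⊥) ⟩
    ⊥                        ∎
    where
    ⊥≈⊥∧⊥⊥′ : ⊥ ≈ ⊥ ∧ (⊥ ∧ ⊥) ′
    ⊥≈⊥∧⊥⊥′ = begin
      ⊥                      ≈⟨ ∧-complementʳ ⊥ ⟨
      ⊥ ∧ ⊤                  ≈⟨ ∧-congˡ ⊤≈⊥⊥′∧⊤ ⟩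
      ⊥ ∧ ((⊥ ∧ ⊥) ′ ∧ ⊤)    ≈⟨ x∙yz≈y∙xz ⊥ ((⊥ ∧ ⊥) ′) ⊤ ⟩
      (⊥ ∧ ⊥) ′ ∧ (⊥ ∧ ⊤)    ≈⟨ ∧-congˡ (∧-complementʳ ⊥) ⟩
      (⊥ ∧ ⊥) ′ ∧ ⊥          ≈⟨ ∧-comm _ _ ⟩
      ⊥ ∧ (⊥ ∧ ⊥) ′          ∎

  ⊤-idem : ⊤ ∧ ⊤ ≈ ⊤
  ⊤-idem = begin
    ⊤ ∧ ⊤            ≈⟨ ∧-congʳ (′-cong ⊥-idem) ⟨
    (⊥ ∧ ⊥) ′ ∧ ⊤    ≈⟨ ⊤≈⊥⊥′∧⊤ ⟨
    ⊤                ∎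

  x≈⊤∧[x′x′]′ : ∀ x → x ≈ ⊤ ∧ (x ′ ∧ x ′) ′
  x≈⊤∧[x′x′]′ x = begin
    x                                ≈⟨ split x x ⟩
    (x ′ ∧ x) ′ ∧ (x ′ ∧ x ′) ′      ≈⟨ ∧-congʳ (′-cong (E.trans (∧-comm _ _) (∧-complementʳ x))) ⟩
    ⊤ ∧ (x ′ ∧ x ′) ′                ∎

  -- Every element already has a factor `⊤`, and `⊤` is idempotent.
  ∧-identityˡ : LeftIdentity ⊤ _∧_
  ∧-identityˡ x = begin
    ⊤ ∧ x                        ≈⟨ ∧-congˡ (x≈⊤∧[x′x′]′ x) ⟩
    ⊤ ∧ (⊤ ∧ (x ′ ∧ x ′) ′)      ≈⟨ ∧-assoc ⊤ ⊤ _ ⟨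
    (⊤ ∧ ⊤) ∧ (x ′ ∧ x ′) ′      ≈⟨ ∧-congʳ ⊤-idem ⟩
    ⊤ ∧ (x ′ ∧ x ′) ′            ≈⟨ x≈⊤∧[x′x′]′ x ⟨
    x                            ∎

  -- With `⊤` neutral, splitting `x ′` along itself says that `x ′` is the complement of
  -- `x ′ ′ ∧ x ′ ′`.
  ∧-idem : Idempotent _∧_
  ∧-idem x = begin
    x ∧ x                    ≈⟨ ′-involutive (x ∧ x) ⟨
    (x ∧ x) ′ ′              ≈⟨ ′-cong (′-cong (∧-cong (′-involutive x) (′-involutive x))) ⟨
    (x ′ ′ ∧ x ′ ′) ′ ′      ≈⟨ ′-cong (∧-identityˡ _) ⟨
    (⊤ ∧ (x ′ ′ ∧ x ′ ′) ′) ′  ≈⟨ ′-cong (x≈⊤∧[x′x′]′ (x ′)) ⟨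
    x ′ ′                    ≈⟨ ′-involutive x ⟩
    x                        ∎

  ∧-zeroʳ : RightZero ⊥ _∧_
  ∧-zeroʳ x = begin
    x ∧ ⊥          ≈⟨ ∧-congˡ (∧-complementʳ x) ⟨
    x ∧ (x ∧ x ′)  ≈⟨ ∧-assoc x x (x ′) ⟨
    (x ∧ x) ∧ x ′  ≈⟨ ∧-congʳ (∧-idem x) ⟩
    x ∧ x ′        ≈⟨ ∧-complementʳ x ⟩
    ⊥              ∎

  -- The lattice order, with x ≤ y expressed by x ∧ y ≈ x

  -- When `x ∧ y ′` vanishes, the second factor of `split′ x y` is `⊤`, which leaves
  -- `x ′ ≈ (x ∧ y) ′`.
  ≤-from-disjoint : ∀ {x y} → x ∧ y ′ ≈ ⊥ → x ∧ y ≈ x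
  ≤-from-disjoint {x} {y} xy′≈⊥ = begin
    x ∧ y                              ≈⟨ ′-involutive (x ∧ y) ⟨
    (x ∧ y) ′ ′                        ≈⟨ ′-cong (∧-identityˡ _) ⟨
    (⊤ ∧ (x ∧ y) ′) ′                  ≈⟨ ′-cong (∧-congʳ (′-cong xy′≈⊥)) ⟨
    ((x ∧ y ′) ′ ∧ (x ∧ y) ′) ′        ≈⟨ ′-cong (∧-comm _ _) ⟩
    ((x ∧ y) ′ ∧ (x ∧ y ′) ′) ′        ≈⟨ ′-cong (split′ x y) ⟨
    x ′ ′                              ≈⟨ ′-involutive x ⟩
    x                                  ∎

  -- The left side lies below `y`, and `x ∧ y` lies below `(x ∧ y ′) ′`; hence both sides equal
  -- `(x ∧ y) ∧ (x ∧ y ′) ′`.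
  x∧[x∧y′]′≈x∧y : ∀ x y → x ∧ (x ∧ y ′) ′ ≈ x ∧ y
  x∧[x∧y′]′≈x∧y x y = begin
    x ∧ (x ∧ y ′) ′          ≈⟨ ≤-from-disjoint below-y ⟨
    (x ∧ (x ∧ y ′) ′) ∧ y    ≈⟨ xy∙z≈xz∙y _ _ _ ⟩
    (x ∧ y) ∧ (x ∧ y ′) ′    ≈⟨ ≤-from-disjoint disjoint ⟩
    x ∧ y                    ∎
    where
    below-y : (x ∧ (x ∧ y ′) ′) ∧ y ′ ≈ ⊥
    below-y = begin
      (x ∧ (x ∧ y ′) ′) ∧ y ′  ≈⟨ xy∙z≈xz∙y _ _ _ ⟩
      (x ∧ y ′) ∧ (x ∧ y ′) ′  ≈⟨ ∧-complementʳ _ ⟩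
      ⊥                        ∎

    disjoint : (x ∧ y) ∧ (x ∧ y ′) ′ ′ ≈ ⊥
    disjoint = begin
      (x ∧ y) ∧ (x ∧ y ′) ′ ′  ≈⟨ ∧-congˡ (′-involutive _) ⟩
      (x ∧ y) ∧ (x ∧ y ′)      ≈⟨ interchange _ _ _ _ ⟩
      (x ∧ x) ∧ (y ∧ y ′)      ≈⟨ ∧-congˡ (∧-complementʳ y) ⟩
      (x ∧ x) ∧ ⊥              ≈⟨ ∧-zeroʳ _ ⟩
      ⊥                        ∎

  -- x ∧ (y ∧ z) ′ is the join of x ∧ y ′ and x ∧ z ′; both sides are complemented.
  ∧-distrib-nand : ∀ x y z → (x ∧ (y ∧ z) ′) ′ ≈ (x ∧ y ′) ′ ∧ (x ∧ z ′) ′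
  ∧-distrib-nand x y z = begin
    -- Antisymmetry: `l` and `r` lie below each other, so each equals their meet.
    (x ∧ (y ∧ z) ′) ′        ≈⟨ l≤r ⟨
    l ∧ r                    ≈⟨ ∧-comm l r ⟩
    r ∧ l                    ≈⟨ ≤-from-disjoint disjoint ⟩
    (x ∧ y ′) ′ ∧ (x ∧ z ′) ′  ∎
    where
    l = (x ∧ (y ∧ z) ′) ′
    r = (x ∧ y ′) ′ ∧ (x ∧ z ′) ′

    l∧x : l ∧ x ≈ x ∧ (y ∧ z)
    l∧x = begin
      l ∧ x                              ≈⟨ ∧-comm l x ⟩
      x ∧ (x ∧ (y ∧ z) ′) ′              ≈⟨ x∧[x∧y′]′≈x∧y x (y ∧ z) ⟩
      x ∧ (y ∧ z)                        ∎

    -- Applied with `w` equal to `y ′` and `z ′`, which gives the two factors of `r`.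
    l≤ : ∀ w → (y ∧ z) ∧ w ≈ ⊥ → l ∧ (x ∧ w) ′ ≈ l
    l≤ w yzw≈⊥ = ≤-from-disjoint (begin
      l ∧ (x ∧ w) ′ ′      ≈⟨ ∧-congˡ (′-involutive _) ⟩
      l ∧ (x ∧ w)          ≈⟨ ∧-assoc l x w ⟨
      (l ∧ x) ∧ w          ≈⟨ ∧-congʳ l∧x ⟩
      (x ∧ (y ∧ z)) ∧ w    ≈⟨ ∧-assoc x (y ∧ z) w ⟩
      x ∧ ((y ∧ z) ∧ w)    ≈⟨ ∧-congˡ yzw≈⊥ ⟩
      x ∧ ⊥                ≈⟨ ∧-zeroʳ x ⟩
      ⊥                    ∎)

    yzy′≈⊥ : (y ∧ z) ∧ y ′ ≈ ⊥
    yzy′≈⊥ = begin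
      (y ∧ z) ∧ y ′  ≈⟨ ∧-congʳ (∧-comm y z) ⟩
      (z ∧ y) ∧ y ′  ≈⟨ ∧-assoc z y (y ′) ⟩
      z ∧ (y ∧ y ′)  ≈⟨ ∧-congˡ (∧-complementʳ y) ⟩
      z ∧ ⊥          ≈⟨ ∧-zeroʳ z ⟩
      ⊥              ∎

    yzz′≈⊥ : (y ∧ z) ∧ z ′ ≈ ⊥
    yzz′≈⊥ = begin
      (y ∧ z) ∧ z ′  ≈⟨ ∧-assoc y z (z ′) ⟩
      y ∧ (z ∧ z ′)  ≈⟨ ∧-congˡ (∧-complementʳ z) ⟩
      y ∧ ⊥          ≈⟨ ∧-zeroʳ y ⟩
      ⊥              ∎

    l≤r : l ∧ r ≈ l
    l≤r = begin
      l ∧ r                              ≈⟨ ∧-assoc l _ _ ⟨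
      (l ∧ (x ∧ y ′) ′) ∧ (x ∧ z ′) ′    ≈⟨ ∧-congʳ (l≤ (y ′) yzy′≈⊥) ⟩
      l ∧ (x ∧ z ′) ′                    ≈⟨ l≤ (z ′) yzz′≈⊥ ⟩
      l                                  ∎

    x∧r : x ∧ r ≈ x ∧ (y ∧ z)
    x∧r = begin
      x ∧ ((x ∧ y ′) ′ ∧ (x ∧ z ′) ′)    ≈⟨ ∧-assoc x _ _ ⟨
      (x ∧ (x ∧ y ′) ′) ∧ (x ∧ z ′) ′    ≈⟨ ∧-congʳ (x∧[x∧y′]′≈x∧y x y) ⟩
      (x ∧ y) ∧ (x ∧ z ′) ′              ≈⟨ xy∙z≈xz∙y _ _ _ ⟩
      (x ∧ (x ∧ z ′) ′) ∧ y              ≈⟨ ∧-congʳ (x∧[x∧y′]′≈x∧y x z) ⟩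
      (x ∧ z) ∧ y                        ≈⟨ xy∙z≈xz∙y _ _ _ ⟩
      (x ∧ y) ∧ z                        ≈⟨ ∧-assoc x y z ⟩
      x ∧ (y ∧ z)                        ∎

    disjoint : r ∧ l ′ ≈ ⊥
    disjoint = begin
      r ∧ l ′                    ≈⟨ ∧-congˡ (′-involutive _) ⟩
      r ∧ (x ∧ (y ∧ z) ′)        ≈⟨ ∧-assoc r x _ ⟨
      (r ∧ x) ∧ (y ∧ z) ′        ≈⟨ ∧-congʳ (E.trans (∧-comm r x) x∧r) ⟩
      (x ∧ (y ∧ z)) ∧ (y ∧ z) ′  ≈⟨ ∧-assoc x _ _ ⟩
      x ∧ ((y ∧ z) ∧ (y ∧ z) ′)  ≈⟨ ∧-congˡ (∧-complementʳ _) ⟩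
      x ∧ ⊥                      ≈⟨ ∧-zeroʳ x ⟩
      ⊥                          ∎

  -- Joins

  infixr 6 _∨_

  _∨_ : Op₂ Carrier
  x ∨ y = (x ′ ∧ y ′) ′

  ∨-cong : Congruent₂ _∨_
  ∨-cong x≈y u≈v = ′-cong (∧-cong (′-cong x≈y) (′-cong u≈v))

  ∨-comm : Commutative _∨_
  ∨-comm x y = ′-cong (∧-comm (x ′) (y ′))

  ∨-assoc : Associative _∨_
  ∨-assoc x y z = ′-cong (begin
    (x ′ ∧ y ′) ′ ′ ∧ z ′    ≈⟨ ∧-congʳ (′-involutive _) ⟩
    (x ′ ∧ y ′) ∧ z ′        ≈⟨ ∧-assoc _ _ _ ⟩
    x ′ ∧ (y ′ ∧ z ′)        ≈⟨ ∧-congˡ (′-involutive _) ⟨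
    x ′ ∧ (y ′ ∧ z ′) ′ ′    ∎)

  -- `x ∨ y` is `x ↑ (y ′)`, one of the two factors of `x` split along `y`, so idempotence absorbs
  -- it.
  ∧-absorbs-∨ : _∧_ Absorbs _∨_
  ∧-absorbs-∨ x y = begin
    x ∧ x ↑ (y ′)                    ≈⟨ merge x y (x ↑ (y ′)) ⟨
    x ↑ (y ′) ∧ (x ↑ y ∧ x ↑ (y ′))  ≈⟨ x∙yz≈y∙xz _ _ _ ⟩
    x ↑ y ∧ (x ↑ (y ′) ∧ x ↑ (y ′))  ≈⟨ ∧-congˡ (∧-idem _) ⟩
    x ↑ y ∧ x ↑ (y ′)                ≈⟨ split x y ⟨
    x                                ∎

  ∨-absorbs-∧ : _∨_ Absorbs _∧_
  ∨-absorbs-∧ x y = begin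
    (x ′ ∧ (x ∧ y) ′) ′
      ≈⟨ ′-cong (∧-congˡ (′-cong (∧-cong (′-involutive x) (′-involutive y)))) ⟨
    (x ′ ∧ (x ′ ∨ y ′)) ′  ≈⟨ ′-cong (∧-absorbs-∨ (x ′) (y ′)) ⟩
    x ′ ′                  ≈⟨ ′-involutive x ⟩
    x                      ∎

  -- This is `∧-distrib-nand` at `x ′`, up to commutativity.
  ∨-distribʳ-∧ : _∨_ DistributesOverʳ _∧_
  ∨-distribʳ-∧ x y z = begin
    ((y ∧ z) ′ ∧ x ′) ′            ≈⟨ ′-cong (∧-comm _ _) ⟩
    (x ′ ∧ (y ∧ z) ′) ′            ≈⟨ ∧-distrib-nand (x ′) y z ⟩
    (x ∨ y) ∧ (x ∨ z)              ≈⟨ ∧-cong (∨-comm x y) (∨-comm x z) ⟩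
    (y ∨ x) ∧ (z ∨ x)              ∎

  isBooleanAlgebra : IsBooleanAlgebra _≈_ _∨_ _∧_ _′ ⊤ ⊥
  isBooleanAlgebra = isBooleanAlgebraʳ record
    { isDistributiveLattice = isDistributiveLatticeʳʲᵐ record
      { isLattice = record
        { isEquivalence = isEquivalence
        ; ∨-comm        = ∨-comm
        ; ∨-assoc       = ∨-assoc
        ; ∨-cong        = ∨-cong
        ; ∧-comm        = ∧-comm
        ; ∧-assoc       = ∧-assoc
        ; ∧-cong        = ∧-cong
        ; absorptive    = ∨-absorbs-∧ , ∧-absorbs-∨
        }
      ; ∨-distribʳ-∧ = ∨-distribʳ-∧
      }
    ; ∨-complementʳ = λ x → ′-cong (∧-complementʳ (x ′))
    ; ∧-complementʳ = ∧-complementʳ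
    ; ¬-cong        = ′-cong
    }

-- Boolean algebras satisfy both identities

module FromBA {a ℓ : Level} (A : Algebra a ℓ) (A∈BA : BA A) where

  open Algebra A

  private
    B : BooleanAlgebra a ℓ
    B = record { isBooleanAlgebra = let _ , _ , _ , h = A∈BA in h }

    module B = BooleanAlgebra B

  open BooleanAlgebraProperties B
    using (deMorgan₁; ¬-involutive; ∨-identityʳ)
  open SetoidReasoning B.setoid

  BA⇒A5 : A ⊨ A5
  BA⇒A5 ρ = begin
    x ∧ (y ∧ z)  ≈⟨ B.∧-assoc x y z ⟨
    (x ∧ y) ∧ z  ≈⟨ B.∧-congʳ (B.∧-comm x y) ⟩
    (y ∧ x) ∧ z  ∎
    where
    x = ρ 0
    y = ρ 1
    z = ρ 2

  -- Join `x` with `⊥`, written as `y ′ ∧ y ′ ′`, and distribute; De Morgan turns each join into a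
  -- complemented meet.
  BA⇒J5′ : A ⊨ J5′
  BA⇒J5′ ρ = begin
    x                                      ≈⟨ ∨-identityʳ x ⟨
    x B.∨ B.⊥                              ≈⟨ B.∨-congˡ (B.∧-complementʳ (y ′)) ⟨
    x B.∨ (y ′ ∧ y ′ ′)                    ≈⟨ B.∨-distribˡ-∧ x (y ′) (y ′ ′) ⟩
    (x B.∨ y ′) ∧ (x B.∨ y ′ ′)            ≈⟨ B.∧-cong (nand y) (nand (y ′)) ⟨
    (x ′ ∧ y) ′ ∧ (x ′ ∧ y ′) ′            ∎
    where
    x = ρ 0
    y = ρ 1
    nand : ∀ w → (x ′ ∧ w) ′ ≈ x B.∨ w ′
    nand w = begin
      (x ′ ∧ w) ′     ≈⟨ deMorgan₁ (x ′) w ⟩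
      x ′ ′ B.∨ w ′   ≈⟨ B.∨-congʳ (¬-involutive x) ⟩
      x B.∨ w ′       ∎

-- Independence, by two-element models

module _ (a ℓ : Level) where

  boolAlgebra : Op₂ Bool → Op₁ Bool → Algebra a ℓ
  boolAlgebra _∙_ f = record
    { Carrier       = Lift a Bool
    ; _≈_           = λ x y → Lift ℓ (lower x ≡ lower y)
    ; isEquivalence = record
      { refl  = lift refl
      ; sym   = λ p → lift (sym (lower p))
      ; trans = λ p q → lift (trans (lower p) (lower q))
      }
    ; _∧_     = λ x y → lift (lower x ∙ lower y)
    ; _′      = λ x → lift (f (lower x))
    ; ∧-cong  = λ p q → lift (cong₂ _∙_ (lower p) (lower q))
    ; ′-cong  = λ p → lift (cong f (lower p))
    ; element = lift true
    }

  -- A model of J5′ in which A5 fails, since its two sides evaluate to `x` and to `y`.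
  leftProjection : Algebra a ℓ
  leftProjection = boolAlgebra const id

  -- A model of A5, as every product is `false`; J5′ fails at `x = true`.
  constantFalse : Algebra a ℓ
  constantFalse = boolAlgebra (λ _ _ → false) id

  -- One assignment refutes both: it makes `x` true and `y` false.
  onlyZeroTrue : ℕ → Lift a Bool
  onlyZeroTrue zero    = lift true
  onlyZeroTrue (suc _) = lift false

  A5-J5′-independent : Independent a ℓ (λ e → e ∈ᵛ (A5 ∷ J5′ ∷ []))
  A5-J5′-independent (here refl) follows
    with () ← lower (follows leftProjection
      (λ { (here refl , f≢A5)         → contradiction refl f≢A5
         ; (there (here refl) , _)    → λ _ → lift refl })
      onlyZeroTrue)
  A5-J5′-independent (there (here refl)) follows
    with () ← lower (follows constantFalse
      (λ { (here refl , _)              → λ _ → lift refl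
         ; (there (here refl) , f≢J5′)  → contradiction refl f≢J5′ })
      onlyZeroTrue)

theorem6p1 : (a ℓ : Level) → IsNBase a ℓ 2 (A5 ∷ J5′ ∷ []) BA
theorem6p1 a ℓ =
    ((λ ()) ∷ []) ∷ [] ∷ []
  , A5-J5′-independent a ℓ
  , λ A → mk⇔
      (λ A⊨ → _ , _ , _ , FromA5-J5′.isBooleanAlgebra A (A⊨ (here refl)) (A⊨ (there (here refl))))
      (λ A∈BA → λ { (here refl)         → FromBA.BA⇒A5 A A∈BA
                  ; (there (here refl)) → FromBA.BA⇒J5′ A A∈BA })
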